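{- Let $\lambda\in\mathbb{R}$, let $n$ be a positive integer and let $k$ be a positive integer. Then \[ S_{k,\lambda}(n)=\frac{(n+1)_{k+1,\lambda}-(1)_{k+1,\lambda}}{k+1}-\frac{1}{k+1}\sum_{r=0}^{k-1}\binom{k+1}{r}(1)_{k+1-r,\lambda}\,S_{r,\lambda}(n). \]
   Context: For $\lambda\in\mathbb{R}$ the degenerate falling factorials are $(x)_{0,\lambda}=1$ and $(x)_{m,\lambda}=x(x-\lambda)(x-2\lambda)\cdots(x-(m-1)\lambda)$ for $m\ge 1$. For a nonnegative integer $r$ and positive integer $n$, $S_{r,\lambda}(n)=\sum_{j=1}^{n}(j)_{r,\lambda}=(1)_{r,\lambda}+(2)_{r,\lambda}+\cdots+(n)_{r,\lambda}$ (so in particular $S_{0,\lambda}(n)=n$). -}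

module Defs where

open import Algebra.Bundles using (CommutativeRing)
open import Algebra.Structures using (IsCommutativeRing)
open import Data.Fin.Base using (toℕ)
open import Data.Integer.Base as ℤ using (+_; 1ℤ)
import Data.Integer.Properties as ℤₚ
open import Data.Nat.Base as ℕ using (ℕ; zero; suc)
import Data.Nat.Properties as ℕₚ
open import Data.Product.Base using (∃-syntax; _×_; _,_)
open import Data.Rational.Base as ℚ using (ℚ; 0ℚ; 1ℚ; ½; ∣_∣)
import Data.Rational.Properties as ℚₚ
open import Data.Rational.Solver using (module +-*-Solver)
open import Data.Rational.Unnormalised.Base as ℚᵘ using (mkℚᵘ; *≡*)
import Data.Rational.Unnormalised.Properties as ℚᵘₚ
open import Level using (0ℓ)
open import Relation.Binary.PropositionalEquality
  using (_≡_; refl; sym; trans; cong; subst; module ≡-Reasoning)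

------------------------------------------------------------------------
-- Real numbers: Cauchy sequences of rationals; two of them are equal when
-- their difference tends to 0.

IsCauchy : (ℕ → ℚ) → Set
IsCauchy x = ∀ ε → 0ℚ ℚ.< ε →
  ∃[ N ] (∀ m n → N ℕ.≤ m → N ℕ.≤ n → ∣ x m ℚ.- x n ∣ ℚ.< ε)

record ℝ : Set where
  constructor mkℝ
  field
    seq    : ℕ → ℚ
    cauchy : IsCauchy seq

open ℝ public

infix 4 _≃_

record _≃_ (x y : ℝ) : Set where
  constructor mk≃
  field
    null : ∀ ε → 0ℚ ℚ.< ε →
      ∃[ N ] (∀ n → N ℕ.≤ n → ∣ seq x n ℚ.- seq y n ∣ ℚ.< ε)

open _≃_ public

private
  open +-*-Solver using (solve; _:+_; _:*_; _:-_; :-_; _:=_; con)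

  opaque
    0<1 : 0ℚ ℚ.< 1ℚ
    0<1 = ℚₚ.positive⁻¹ 1ℚ

  opaque
    -- A single ε-δ estimate behind the continuity of all ring operations.
    estimate : ∀ K → 0ℚ ℚ.< K → ∀ ε → 0ℚ ℚ.< ε →
      ∃[ δ ] (0ℚ ℚ.< δ × (∀ a b d e →
        ∣ a ∣ ℚ.≤ K → ∣ b ∣ ℚ.≤ K → ∣ d ∣ ℚ.< δ → ∣ e ∣ ℚ.< δ →
        ∣ a ℚ.* d ℚ.+ b ℚ.* e ∣ ℚ.< ε))
    estimate K K>0 ε ε>0 = δ , δ>0 , bound
      where
      instance
        K⁺ : ℚ.Positive K
        K⁺ = ℚ.positive K>0
        K≢0 : ℚ.NonZero K
        K≢0 = ℚₚ.pos⇒nonZero K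
        ε⁺ : ℚ.Positive ε
        ε⁺ = ℚ.positive ε>0
        K⁻¹⁺ : ℚ.Positive (ℚ.1/ K)
        K⁻¹⁺ = ℚₚ.1/pos⇒pos K
        ½ε⁺ : ℚ.Positive (½ ℚ.* ε)
        ½ε⁺ = ℚₚ.pos*pos⇒pos ½ ε
        δ⁺ : ℚ.Positive ((½ ℚ.* ε) ℚ.* ℚ.1/ K)
        δ⁺ = ℚₚ.pos*pos⇒pos (½ ℚ.* ε) (ℚ.1/ K)

      δ : ℚ
      δ = (½ ℚ.* ε) ℚ.* ℚ.1/ K

      δ>0 : 0ℚ ℚ.< δ
      δ>0 = ℚₚ.positive⁻¹ δ

      Kδ : K ℚ.* δ ≡ ½ ℚ.* ε
      Kδ = begin
        K ℚ.* ((½ ℚ.* ε) ℚ.* ℚ.1/ K) ≡⟨ solve 3 (λ k e i → k :* (e :* i) := e :* (k :* i)) refl K (½ ℚ.* ε) (ℚ.1/ K) ⟩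
        (½ ℚ.* ε) ℚ.* (K ℚ.* ℚ.1/ K) ≡⟨ cong ((½ ℚ.* ε) ℚ.*_) (ℚₚ.*-inverseʳ K) ⟩
        (½ ℚ.* ε) ℚ.* 1ℚ             ≡⟨ ℚₚ.*-identityʳ _ ⟩
        ½ ℚ.* ε                      ∎
        where open ≡-Reasoning

      half : ½ ℚ.* ε ℚ.+ ½ ℚ.* ε ≡ ε
      half = trans (sym (ℚₚ.*-distribʳ-+ ε ½ ½)) (ℚₚ.*-identityˡ ε)

      term : ∀ a d → ∣ a ∣ ℚ.≤ K → ∣ d ∣ ℚ.< δ → ∣ a ℚ.* d ∣ ℚ.< ½ ℚ.* ε
      term a d a≤K d<δ = begin-strict
        ∣ a ℚ.* d ∣     ≡⟨ ℚₚ.∣p*q∣≡∣p∣*∣q∣ a d ⟩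
        ∣ a ∣ ℚ.* ∣ d ∣ ≤⟨ ℚₚ.*-monoʳ-≤-nonNeg ∣ d ∣ {{ℚₚ.∣-∣-nonNeg d}} a≤K ⟩
        K ℚ.* ∣ d ∣     <⟨ ℚₚ.*-monoʳ-<-pos K d<δ ⟩
        K ℚ.* δ         ≡⟨ Kδ ⟩
        ½ ℚ.* ε         ∎
        where open ℚₚ.≤-Reasoning

      bound : ∀ a b d e → ∣ a ∣ ℚ.≤ K → ∣ b ∣ ℚ.≤ K →
        ∣ d ∣ ℚ.< δ → ∣ e ∣ ℚ.< δ → ∣ a ℚ.* d ℚ.+ b ℚ.* e ∣ ℚ.< ε
      bound a b d e a≤K b≤K d<δ e<δ = begin-strict
        ∣ a ℚ.* d ℚ.+ b ℚ.* e ∣         ≤⟨ ℚₚ.∣p+q∣≤∣p∣+∣q∣ (a ℚ.* d) (b ℚ.* e) ⟩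
        ∣ a ℚ.* d ∣ ℚ.+ ∣ b ℚ.* e ∣     <⟨ ℚₚ.+-mono-< (term a d a≤K d<δ) (term b e b≤K e<δ) ⟩
        ½ ℚ.* ε ℚ.+ ½ ℚ.* ε             ≡⟨ half ⟩
        ε                               ∎
        where open ℚₚ.≤-Reasoning

  opaque
    ⊔-≤ˡ : ∀ M N {n} → M ℕ.⊔ N ℕ.≤ n → M ℕ.≤ n
    ⊔-≤ˡ M N = ℕₚ.≤-trans (ℕₚ.m≤m⊔n M N)

    ⊔-≤ʳ : ∀ M N {n} → M ℕ.⊔ N ℕ.≤ n → N ℕ.≤ n
    ⊔-≤ʳ M N = ℕₚ.≤-trans (ℕₚ.m≤n⊔m M N)

  opaque
    eventuallyBounded : ∀ x → ∃[ N ] ∃[ K ] (0ℚ ℚ.< K × (∀ n → N ℕ.≤ n → ∣ seq x n ∣ ℚ.≤ K))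
    eventuallyBounded x with cauchy x 1ℚ 0<1
    ... | N , h = N , 1ℚ ℚ.+ ∣ seq x N ∣ , K>0 , bound
      where
      K>0 : 0ℚ ℚ.< 1ℚ ℚ.+ ∣ seq x N ∣
      K>0 = ℚₚ.+-mono-<-≤ 0<1 (ℚₚ.0≤∣p∣ (seq x N))

      bound : ∀ n → N ℕ.≤ n → ∣ seq x n ∣ ℚ.≤ 1ℚ ℚ.+ ∣ seq x N ∣
      bound n N≤n = begin
        ∣ seq x n ∣                                 ≡⟨ cong ∣_∣ (solve 2 (λ a b → a := (a :- b) :+ b) refl (seq x n) (seq x N)) ⟩
        ∣ (seq x n ℚ.- seq x N) ℚ.+ seq x N ∣       ≤⟨ ℚₚ.∣p+q∣≤∣p∣+∣q∣ (seq x n ℚ.- seq x N) (seq x N) ⟩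
        ∣ seq x n ℚ.- seq x N ∣ ℚ.+ ∣ seq x N ∣     ≤⟨ ℚₚ.+-monoˡ-≤ ∣ seq x N ∣ (ℚₚ.<⇒≤ (h n N N≤n ℕₚ.≤-refl)) ⟩
        1ℚ ℚ.+ ∣ seq x N ∣                          ∎
        where open ℚₚ.≤-Reasoning

  opaque
    ∣x∣≤K+L : ∀ {p} K L → 0ℚ ℚ.< L → ∣ p ∣ ℚ.≤ K → ∣ p ∣ ℚ.≤ K ℚ.+ L
    ∣x∣≤K+L {p} K L L>0 p≤K =
      subst (ℚ._≤ K ℚ.+ L) (ℚₚ.+-identityʳ ∣ p ∣) (ℚₚ.+-mono-≤ p≤K (ℚₚ.<⇒≤ L>0))

  opaque
    commonBound : ∀ x y → ∃[ N ] ∃[ K ] (0ℚ ℚ.< K ×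
      (∀ n → N ℕ.≤ n → ∣ seq x n ∣ ℚ.≤ K × ∣ seq y n ∣ ℚ.≤ K))
    commonBound x y with eventuallyBounded x | eventuallyBounded y
    ... | M , K , K>0 , hx | N , L , L>0 , hy = M ℕ.⊔ N , K ℚ.+ L , pos , bound
      where
      pos : 0ℚ ℚ.< K ℚ.+ L
      pos = ℚₚ.+-mono-< {0ℚ} {K} {0ℚ} {L} K>0 L>0

      boundˡ : ∀ n → M ℕ.≤ n → ∣ seq x n ∣ ℚ.≤ K ℚ.+ L
      boundˡ n h = ∣x∣≤K+L {seq x n} K L L>0 (hx n h)

      boundʳ : ∀ n → N ℕ.≤ n → ∣ seq y n ∣ ℚ.≤ K ℚ.+ L
      boundʳ n h = subst (∣ seq y n ∣ ℚ.≤_) (ℚₚ.+-comm L K) (∣x∣≤K+L {seq y n} L K K>0 (hy n h))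

      bound : ∀ n → M ℕ.⊔ N ℕ.≤ n → ∣ seq x n ∣ ℚ.≤ K ℚ.+ L × ∣ seq y n ∣ ℚ.≤ K ℚ.+ L
      bound n h = boundˡ n (⊔-≤ˡ M N h) , boundʳ n (⊔-≤ʳ M N h)

ι : ℚ → ℝ
ι q = mkℝ (λ _ → q) λ ε ε>0 → 0 , λ _ _ _ _ →
  subst (ℚ._< ε) (sym (cong ∣_∣ (ℚₚ.+-inverseʳ q))) ε>0

infixl 6 _+ℝ_
infixl 7 _*ℝ_
infix  8 -ℝ_

private opaque
  +-cauchy : ∀ x y → IsCauchy (λ n → seq x n ℚ.+ seq y n)
  +-cauchy x y ε ε>0 with estimate 1ℚ 0<1 ε ε>0
  ... | δ , δ>0 , est with cauchy x δ δ>0 | cauchy y δ δ>0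
  ... | M , hx | N , hy = M ℕ.⊔ N , λ m n p q →
    subst (λ z → ∣ z ∣ ℚ.< ε)
      (solve 4 (λ a b c d → con 1ℚ :* (a :- b) :+ con 1ℚ :* (c :- d) := (a :+ c) :- (b :+ d)) refl
        (seq x m) (seq x n) (seq y m) (seq y n))
      (est 1ℚ 1ℚ _ _ ℚₚ.≤-refl ℚₚ.≤-refl
        (hx m n (⊔-≤ˡ M N p) (⊔-≤ˡ M N q)) (hy m n (⊔-≤ʳ M N p) (⊔-≤ʳ M N q)))

_+ℝ_ : ℝ → ℝ → ℝ
x +ℝ y = mkℝ (λ n → seq x n ℚ.+ seq y n) (+-cauchy x y)

private opaque
  -‿cauchy : ∀ x → IsCauchy (λ n → ℚ.- seq x n)
  -‿cauchy x ε ε>0 with cauchy x ε ε>0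
  ... | N , h = N , λ m n p q →
    subst (λ z → ∣ z ∣ ℚ.< ε)
      (solve 2 (λ a b → b :- a := (:- a) :- (:- b)) refl (seq x m) (seq x n))
      (h n m q p)

-ℝ_ : ℝ → ℝ
-ℝ x = mkℝ (λ n → ℚ.- seq x n) (-‿cauchy x)

private opaque
  *-cauchy : ∀ x y → IsCauchy (λ n → seq x n ℚ.* seq y n)
  *-cauchy x y ε ε>0 with commonBound x y
  ... | L , K , K>0 , b with estimate K K>0 ε ε>0
  ... | δ , δ>0 , est with cauchy x δ δ>0 | cauchy y δ δ>0
  ... | M , hx | N , hy = L ℕ.⊔ (M ℕ.⊔ N) , λ m n p q →
    let p′ = ⊔-≤ʳ L (M ℕ.⊔ N) p
        q′ = ⊔-≤ʳ L (M ℕ.⊔ N) q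
        (bx , _) = b m (⊔-≤ˡ L (M ℕ.⊔ N) p)
        (_ , by) = b n (⊔-≤ˡ L (M ℕ.⊔ N) q)
    in subst (λ z → ∣ z ∣ ℚ.< ε)
      (solve 4 (λ a b c d → a :* (c :- d) :+ d :* (a :- b) := a :* c :- b :* d) refl
        (seq x m) (seq x n) (seq y m) (seq y n))
      (est (seq x m) (seq y n) _ _ bx by
        (hy m n (⊔-≤ʳ M N p′) (⊔-≤ʳ M N q′)) (hx m n (⊔-≤ˡ M N p′) (⊔-≤ˡ M N q′)))

_*ℝ_ : ℝ → ℝ → ℝ
x *ℝ y = mkℝ (λ n → seq x n ℚ.* seq y n) (*-cauchy x y)

pointwise : ∀ {x y} → (∀ n → seq x n ≡ seq y n) → x ≃ y
pointwise {x} {y} e = mk≃ λ ε ε>0 → 0 , λ n _ →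
  subst (λ z → ∣ z ∣ ℚ.< ε)
    (sym (trans (cong (ℚ._- seq y n) (e n)) (ℚₚ.+-inverseʳ (seq y n)))) ε>0

private
  ≃-sym : ∀ {x y} → x ≃ y → y ≃ x
  ≃-sym {x} {y} (mk≃ e) = mk≃ λ ε ε>0 → let (N , h) = e ε ε>0 in N , λ n p →
    subst (ℚ._< ε)
      (trans (sym (ℚₚ.∣-p∣≡∣p∣ (seq x n ℚ.- seq y n)))
        (cong ∣_∣ (solve 2 (λ a b → :- (a :- b) := b :- a) refl (seq x n) (seq y n))))
      (h n p)

  ≃-trans : ∀ {x y z} → x ≃ y → y ≃ z → x ≃ z
  ≃-trans {x} {y} {z} (mk≃ e) (mk≃ f) = mk≃ g
    where
    g : ∀ ε → 0ℚ ℚ.< ε → ∃[ N ] (∀ n → N ℕ.≤ n → ∣ seq x n ℚ.- seq z n ∣ ℚ.< ε)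
    g ε ε>0 with estimate 1ℚ 0<1 ε ε>0
    ... | δ , δ>0 , est with e δ δ>0 | f δ δ>0
    ... | M , hx | N , hy = M ℕ.⊔ N , λ n p →
      subst (λ w → ∣ w ∣ ℚ.< ε)
        (solve 3 (λ a b c → con 1ℚ :* (a :- b) :+ con 1ℚ :* (b :- c) := a :- c) refl
          (seq x n) (seq y n) (seq z n))
        (est 1ℚ 1ℚ _ _ ℚₚ.≤-refl ℚₚ.≤-refl (hx n (⊔-≤ˡ M N p)) (hy n (⊔-≤ʳ M N p)))

  +-cong : ∀ {x x′ y y′} → x ≃ x′ → y ≃ y′ → x +ℝ y ≃ x′ +ℝ y′
  +-cong {x} {x′} {y} {y′} (mk≃ e) (mk≃ f) = mk≃ g
    where
    g : ∀ ε → 0ℚ ℚ.< ε → ∃[ N ] (∀ n → N ℕ.≤ n →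
      ∣ seq (x +ℝ y) n ℚ.- seq (x′ +ℝ y′) n ∣ ℚ.< ε)
    g ε ε>0 with estimate 1ℚ 0<1 ε ε>0
    ... | δ , δ>0 , est with e δ δ>0 | f δ δ>0
    ... | M , hx | N , hy = M ℕ.⊔ N , λ n p →
      subst (λ z → ∣ z ∣ ℚ.< ε)
        (solve 4 (λ a b c d → con 1ℚ :* (a :- b) :+ con 1ℚ :* (c :- d) := (a :+ c) :- (b :+ d)) refl
          (seq x n) (seq x′ n) (seq y n) (seq y′ n))
        (est 1ℚ 1ℚ _ _ ℚₚ.≤-refl ℚₚ.≤-refl (hx n (⊔-≤ˡ M N p)) (hy n (⊔-≤ʳ M N p)))

  -‿cong : ∀ {x y} → x ≃ y → -ℝ x ≃ -ℝ y
  -‿cong {x} {y} (mk≃ e) = mk≃ λ ε ε>0 → let (N , h) = e ε ε>0 in N , λ n p →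
    subst (ℚ._< ε)
      (trans (sym (ℚₚ.∣-p∣≡∣p∣ (seq x n ℚ.- seq y n)))
        (cong ∣_∣ (solve 2 (λ a b → :- (a :- b) := (:- a) :- (:- b)) refl (seq x n) (seq y n))))
      (h n p)

  *-cong : ∀ {x x′ y y′} → x ≃ x′ → y ≃ y′ → x *ℝ y ≃ x′ *ℝ y′
  *-cong {x} {x′} {y} {y′} (mk≃ e) (mk≃ f) = mk≃ g
    where
    g : ∀ ε → 0ℚ ℚ.< ε → ∃[ N ] (∀ n → N ℕ.≤ n →
      ∣ seq (x *ℝ y) n ℚ.- seq (x′ *ℝ y′) n ∣ ℚ.< ε)
    g ε ε>0 with commonBound x y′
    ... | L , K , K>0 , b with estimate K K>0 ε ε>0
    ... | δ , δ>0 , est with e δ δ>0 | f δ δ>0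
    ... | M , hx | N , hy = L ℕ.⊔ (M ℕ.⊔ N) , λ n p →
      let p′ = ⊔-≤ʳ L (M ℕ.⊔ N) p
          (bx , by) = b n (⊔-≤ˡ L (M ℕ.⊔ N) p)
      in subst (λ z → ∣ z ∣ ℚ.< ε)
        (solve 4 (λ a b c d → a :* (c :- d) :+ d :* (a :- b) := a :* c :- b :* d) refl
          (seq x n) (seq x′ n) (seq y n) (seq y′ n))
        (est (seq x n) (seq y′ n) _ _ bx by (hy n (⊔-≤ʳ M N p′)) (hx n (⊔-≤ˡ M N p′)))

  ℝ-isCommutativeRing : IsCommutativeRing _≃_ _+ℝ_ _*ℝ_ -ℝ_ (ι 0ℚ) (ι 1ℚ)
  ℝ-isCommutativeRing = record
    { isRing = record
      { +-isAbelianGroup = record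
        { isGroup = record
          { isMonoid = record
            { isSemigroup = record
              { isMagma = record
                { isEquivalence = record
                  { refl  = pointwise λ _ → refl
                  ; sym   = ≃-sym
                  ; trans = ≃-trans
                  }
                ; ∙-cong = +-cong
                }
              ; assoc = λ x y z → pointwise λ n → ℚₚ.+-assoc (seq x n) (seq y n) (seq z n)
              }
            ; identity = (λ x → pointwise λ n → ℚₚ.+-identityˡ (seq x n))
                       , (λ x → pointwise λ n → ℚₚ.+-identityʳ (seq x n))
            }
          ; inverse = (λ x → pointwise λ n → ℚₚ.+-inverseˡ (seq x n))
                    , (λ x → pointwise λ n → ℚₚ.+-inverseʳ (seq x n))
          ; ⁻¹-cong = -‿cong
          }
        ; comm = λ x y → pointwise λ n → ℚₚ.+-comm (seq x n) (seq y n)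
        }
      ; *-cong = *-cong
      ; *-assoc = λ x y z → pointwise λ n → ℚₚ.*-assoc (seq x n) (seq y n) (seq z n)
      ; *-identity = (λ x → pointwise λ n → ℚₚ.*-identityˡ (seq x n))
                   , (λ x → pointwise λ n → ℚₚ.*-identityʳ (seq x n))
      ; distrib = (λ x y z → pointwise λ n → ℚₚ.*-distribˡ-+ (seq x n) (seq y n) (seq z n))
                , (λ x y z → pointwise λ n → ℚₚ.*-distribʳ-+ (seq x n) (seq y n) (seq z n))
      }
    ; *-comm = λ x y → pointwise λ n → ℚₚ.*-comm (seq x n) (seq y n)
    }

ℝ-commutativeRing : CommutativeRing 0ℓ 0ℓ
ℝ-commutativeRing = record { isCommutativeRing = ℝ-isCommutativeRing }

open CommutativeRing ℝ-commutativeRing public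
  using (_+_; _*_; _-_; 1#)

open import Algebra.Properties.Monoid.Sum
  (CommutativeRing.+-monoid ℝ-commutativeRing) public using (sum-syntax)

open import Algebra.Definitions.RawMonoid
  (CommutativeRing.+-rawMonoid ℝ-commutativeRing) using () renaming (_×_ to _·_)

fromℕ : ℕ → ℝ
fromℕ n = n · 1#

-- Multiplication by the constant sequence 1/d; /-cancel below shows that this
-- is division by d.
infixl 7 _/_

_/_ : ℝ → (d : ℕ) → .{{ℕ.NonZero d}} → ℝ
x / d = x * ι (1ℤ ℚ./ d)

private
  seq-fromℕ : ∀ n m → seq (fromℕ n) m ≡ (+ n) ℚ./ 1
  seq-fromℕ zero    m = refl
  seq-fromℕ (suc n) m = trans (cong (1ℚ ℚ.+_) (seq-fromℕ n m)) (ℚₚ.toℚᵘ-injective (begin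
    ℚ.toℚᵘ (1ℚ ℚ.+ (+ n) ℚ./ 1)            ≈⟨ ℚₚ.toℚᵘ-homo-+ 1ℚ ((+ n) ℚ./ 1) ⟩
    ℚ.toℚᵘ 1ℚ ℚᵘ.+ ℚ.toℚᵘ ((+ n) ℚ./ 1)    ≈⟨ ℚᵘₚ.+-congʳ (ℚ.toℚᵘ 1ℚ) (ℚₚ.toℚᵘ-fromℚᵘ (mkℚᵘ (+ n) 0)) ⟩
    ℚ.toℚᵘ 1ℚ ℚᵘ.+ mkℚᵘ (+ n) 0            ≈⟨ *≡* (cong (λ z → (1ℤ ℤ.+ z) ℤ.* 1ℤ) (ℤₚ.*-identityʳ (+ n))) ⟩
    mkℚᵘ (+ suc n) 0                       ≈⟨ ℚₚ.toℚᵘ-fromℚᵘ (mkℚᵘ (+ suc n) 0) ⟨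
    ℚ.toℚᵘ ((+ suc n) ℚ./ 1)               ∎))
    where open ℚᵘₚ.≃-Reasoning

  n*1/n : ∀ d → (+ suc d) ℚ./ 1 ℚ.* (1ℤ ℚ./ suc d) ≡ 1ℚ
  n*1/n d = ℚₚ.toℚᵘ-injective (begin
    ℚ.toℚᵘ ((+ suc d) ℚ./ 1 ℚ.* (1ℤ ℚ./ suc d))            ≈⟨ ℚₚ.toℚᵘ-homo-* ((+ suc d) ℚ./ 1) (1ℤ ℚ./ suc d) ⟩
    ℚ.toℚᵘ ((+ suc d) ℚ./ 1) ℚᵘ.* ℚ.toℚᵘ (1ℤ ℚ./ suc d)    ≈⟨ ℚᵘₚ.*-cong (ℚₚ.toℚᵘ-fromℚᵘ (mkℚᵘ (+ suc d) 0)) (ℚₚ.toℚᵘ-fromℚᵘ (mkℚᵘ 1ℤ d)) ⟩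
    mkℚᵘ (+ suc d) 0 ℚᵘ.* mkℚᵘ 1ℤ d                        ≈⟨ *≡* (trans (ℤₚ.*-identityʳ _) (trans (ℤₚ.*-identityʳ _) (trans (cong (λ z → + suc z) (sym (ℕₚ.+-identityʳ d))) (sym (ℤₚ.*-identityˡ _))))) ⟩
    ℚ.toℚᵘ 1ℚ                                              ∎)
    where open ℚᵘₚ.≃-Reasoning

/-cancel : ∀ x d .{{_ : ℕ.NonZero d}} → fromℕ d * (x / d) ≃ x
/-cancel x (suc d) = pointwise λ m → begin
  seq (fromℕ (suc d)) m ℚ.* (seq x m ℚ.* r)     ≡⟨ cong (ℚ._* (seq x m ℚ.* r)) (seq-fromℕ (suc d) m) ⟩
  (+ suc d) ℚ./ 1 ℚ.* (seq x m ℚ.* r)           ≡⟨ solve 3 (λ a b c → a :* (b :* c) := b :* (a :* c)) refl ((+ suc d) ℚ./ 1) (seq x m) r ⟩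
  seq x m ℚ.* ((+ suc d) ℚ./ 1 ℚ.* r)           ≡⟨ cong (seq x m ℚ.*_) (n*1/n d) ⟩
  seq x m ℚ.* 1ℚ                                ≡⟨ ℚₚ.*-identityʳ (seq x m) ⟩
  seq x m                                       ∎
  where
  open ≡-Reasoning
  r : ℚ
  r = 1ℤ ℚ./ suc d

------------------------------------------------------------------------
-- Degenerate falling factorials and their power sums

-- ⟨ x ⟩[ m , l ] = x (x - l) (x - 2 l) ⋯ (x - (m - 1) l)
⟨_⟩[_,_] : ℝ → ℕ → ℝ → ℝ
⟨ x ⟩[ zero  , l ] = 1#
⟨ x ⟩[ suc m , l ] = ⟨ x ⟩[ m , l ] * (x - fromℕ m * l)

-- The index j : Fin n stands for the summand j + 1 of the sum over 1, …, n.
S : ℕ → ℝ → ℕ → ℝ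
S r l n = ∑[ j < n ] ⟨ fromℕ (suc (toℕ j)) ⟩[ r , l ]

{-# OPTIONS --safe #-}

-- Vandermonde's identity at (1 , x),
--   ⟨ 1 + x ⟩ₖ₊₁ = Σ_{r ≤ k+1} C(k+1, r) ⟨ x ⟩ᵣ ⟨ 1 ⟩ₖ₊₁₋ᵣ,
-- has ⟨ x ⟩ₖ₊₁ as its top term, so summing it over x = 1, …, n telescopes.
-- The term r = k of what remains is (k + 1) S k l n; solve for S k l n.
module Submission where

open import Defs
open import Algebra.Bundles using (CommutativeRing)
open import Data.Fin.Base using (toℕ)
open import Data.Fin.Properties using (toℕ<n; toℕ-fromℕ; toℕ-inject₁)
open import Data.Nat.Base as ℕ using (ℕ; zero; suc; _∸_; s≤s⁻¹; NonZero)
open import Data.Nat.Combinatorics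
  using (_C_; nCn≡1; nC1≡n; nCk≡nC[n∸k]; k>n⇒nCk≡0; nCk+nC[k+1]≡[n+1]C[k+1])
import Data.Nat.Properties as ℕₚ
open import Function.Base using (_∘_)
open import Relation.Binary.PropositionalEquality as ≡ using (_≡_)

open CommutativeRing ℝ-commutativeRing
  using ( -_; 0#; refl; sym; trans; reflexive; setoid
        ; +-cong; +-congˡ; +-congʳ; +-identityˡ; +-identityʳ; -‿cong
        ; *-cong; *-congˡ; *-congʳ; *-comm; *-identityˡ; *-identityʳ; zeroˡ; distribʳ
        ; semiring; commutativeSemiring; +-group; +-abelianGroup; +-monoid)

open import Algebra.Properties.Semiring.Sum semiring
  using (sum-cong-≋; sum-init-last; ∑-distrib-+; ∑-comm; *-distribˡ-sum)
open import Algebra.Properties.Monoid.Mult +-monoid using (×-homo-+)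
open import Algebra.Properties.Group +-group using (//-rightDividesʳ)
open import Algebra.Properties.AbelianGroup +-abelianGroup using (⁻¹-∙-comm)
open import Algebra.Solver.Ring.NaturalCoefficients.Default commutativeSemiring
  using (solve; _:+_; _:*_; _:=_)
open import Relation.Binary.Reasoning.Setoid setoid

-- Sums over `Fin` unfold from the front. Taking the summand as a function on `ℕ` hides the index
-- conversions `inject₁` and `fromℕ` that splitting off the last term brings in.
∑-last : ∀ n (f : ℕ → ℝ) →
  ∑[ i < suc n ] f (toℕ i) ≃ ∑[ i < n ] f (toℕ i) + f n
∑-last n f = trans (sum-init-last {n} (f ∘ toℕ)) (+-cong
  (sum-cong-≋ {n} λ i → reflexive (≡.cong f (toℕ-inject₁ i)))
  (reflexive (≡.cong f (toℕ-fromℕ n))))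

∑-telescope : ∀ (g d : ℕ → ℝ) → (∀ j → g (suc j) ≃ d j + g j) →
  ∀ n → g n ≃ ∑[ j < n ] d (toℕ j) + g 0
∑-telescope g d step zero    = sym (+-identityˡ (g 0))
∑-telescope g d step (suc n) = begin
  g (suc n)                              ≈⟨ step n ⟩
  d n + g n                              ≈⟨ +-congˡ (∑-telescope g d step n) ⟩
  d n + (∑d + g 0)                       ≈⟨ solve 3 (λ a b c → a :+ (b :+ c) := (b :+ a) :+ c) refl (d n) ∑d (g 0) ⟩
  ∑d + d n + g 0                         ≈⟨ +-congʳ (sym (∑-last n d)) ⟩
  ∑[ j < suc n ] d (toℕ j) + g 0         ∎
  where
  ∑d : ℝ
  ∑d = ∑[ j < n ] d (toℕ j)

fromℕ-homo-+ : ∀ m n → fromℕ (m ℕ.+ n) ≃ fromℕ m + fromℕ n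
fromℕ-homo-+ = ×-homo-+ 1#

fromℕ-1 : fromℕ 1 ≃ 1#
fromℕ-1 = +-identityʳ 1#

-- Pascal's rule splits each term past the first. The `m C r` halves give `∑u`; the `m C suc r`
-- halves, joined to the first term, give `∑w`, whose extra top term vanishes. With the products of
-- factorials as `f`, this is the combinatorial half of the Vandermonde induction.
∑-pascal : ∀ m (f : ℕ → ℝ) →
  ∑[ r < suc (suc m) ] (fromℕ (suc m C toℕ r) * f (toℕ r)) ≃
  ∑[ r < suc m ] (fromℕ (m C toℕ r) * (f (toℕ r) + f (suc (toℕ r))))
∑-pascal m f = begin
  c′ 0 * f 0 + ∑[ r < suc m ] (c′ (suc (toℕ r)) * f (suc (toℕ r)))
    -- The head needs no rewriting: `suc m C 0` and `m C 0` both compute to 1.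
    ≈⟨ +-congˡ (sum-cong-≋ {suc m} λ r → expand (toℕ r)) ⟩
  c 0 * f 0 + ∑[ r < suc m ] (u (toℕ r) + v (toℕ r))
    ≈⟨ +-congˡ (∑-distrib-+ {suc m} (u ∘ toℕ) (v ∘ toℕ)) ⟩
  c 0 * f 0 + (∑u + ∑v)
    ≈⟨ solve 3 (λ a b d → a :+ (b :+ d) := (a :+ d) :+ b) refl (c 0 * f 0) ∑u ∑v ⟩
  ∑[ r < suc (suc m) ] w (toℕ r) + ∑u
    ≈⟨ +-congʳ (∑-last (suc m) w) ⟩
  ∑w + w (suc m) + ∑u
    ≈⟨ +-congʳ (trans (+-congˡ w-top≃0) (+-identityʳ ∑w)) ⟩
  ∑w + ∑u
    ≈⟨ sym (∑-distrib-+ {suc m} (w ∘ toℕ) (u ∘ toℕ)) ⟩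
  ∑[ r < suc m ] (w (toℕ r) + u (toℕ r))
    ≈⟨ sum-cong-≋ {suc m} (λ r → solve 3 (λ a b d → a :* b :+ a :* d := a :* (b :+ d)) refl
         (c (toℕ r)) (f (toℕ r)) (f (suc (toℕ r)))) ⟩
  ∑[ r < suc m ] (c (toℕ r) * (f (toℕ r) + f (suc (toℕ r)))) ∎
  where
  c c′ u v w : ℕ → ℝ
  c  r = fromℕ (m C r)
  c′ r = fromℕ (suc m C r)
  u  r = c r * f (suc r)
  v  r = c (suc r) * f (suc r)
  w  r = c r * f r

  ∑u ∑v ∑w : ℝ
  ∑u = ∑[ r < suc m ] u (toℕ r)
  ∑v = ∑[ r < suc m ] v (toℕ r)
  ∑w = ∑[ r < suc m ] w (toℕ r)

  expand : ∀ r → c′ (suc r) * f (suc r) ≃ u r + v r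
  expand r = begin
    fromℕ (suc m C suc r) * f (suc r)
      ≈⟨ *-congʳ (reflexive (≡.cong fromℕ (≡.sym (nCk+nC[k+1]≡[n+1]C[k+1] m r)))) ⟩
    fromℕ (m C r ℕ.+ m C suc r) * f (suc r)
      ≈⟨ *-congʳ (fromℕ-homo-+ (m C r) (m C suc r)) ⟩
    (c r + c (suc r)) * f (suc r)
      ≈⟨ distribʳ (f (suc r)) (c r) (c (suc r)) ⟩
    u r + v r ∎

  w-top≃0 : w (suc m) ≃ 0#
  w-top≃0 = trans
    (*-congʳ (reflexive (≡.cong fromℕ (k>n⇒nCk≡0 (ℕₚ.n<1+n m)))))
    (zeroˡ (f (suc m)))

⟨⟩-cong : ∀ {x y} m l → x ≃ y → ⟨ x ⟩[ m , l ] ≃ ⟨ y ⟩[ m , l ]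
⟨⟩-cong zero    l x≃y = refl
⟨⟩-cong (suc m) l x≃y = *-cong (⟨⟩-cong m l x≃y) (+-congʳ x≃y)

⟨⟩-1 : ∀ x l → ⟨ x ⟩[ 1 , l ] ≃ x
⟨⟩-1 x l = begin
  1# * (x - 0# * l)   ≈⟨ *-identityˡ (x - 0# * l) ⟩
  x - 0# * l          ≈⟨ +-congˡ (-‿cong (zeroˡ l)) ⟩
  x - 0#              ≈⟨ sym (+-congʳ (+-identityʳ x)) ⟩
  x + 0# - 0#         ≈⟨ //-rightDividesʳ 0# x ⟩
  x                   ∎

-- For `r + s = m` the last factor of the factorial of `y + x` breaks into the factor that extends
-- `⟨ x ⟩[ r , l ]` and the one that extends `⟨ y ⟩[ s , l ]`.
factor-split : ∀ x y l r s →
  y + x - fromℕ (r ℕ.+ s) * l ≃ (x - fromℕ r * l) + (y - fromℕ s * l)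
factor-split x y l r s = begin
  y + x - fromℕ (r ℕ.+ s) * l
    ≈⟨ +-congˡ (-‿cong (trans (*-congʳ (fromℕ-homo-+ r s)) (distribʳ l (fromℕ r) (fromℕ s)))) ⟩
  y + x - (fromℕ r * l + fromℕ s * l)
    ≈⟨ +-congˡ (sym (⁻¹-∙-comm (fromℕ r * l) (fromℕ s * l))) ⟩
  y + x + (- (fromℕ r * l) + - (fromℕ s * l))
    ≈⟨ solve 4 (λ x y a b → (y :+ x) :+ (a :+ b) := (x :+ a) :+ (y :+ b)) refl
         x y (- (fromℕ r * l)) (- (fromℕ s * l)) ⟩
  (x - fromℕ r * l) + (y - fromℕ s * l) ∎

-- Induction on `m`: the new factor `z` is split differently in each summand, according to its `r`,
-- and `∑-pascal` collects the results.
vandermonde : ∀ x y l m → ⟨ y + x ⟩[ m , l ] ≃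
  ∑[ r < suc m ] (fromℕ (m C toℕ r) * (⟨ x ⟩[ toℕ r , l ] * ⟨ y ⟩[ m ∸ toℕ r , l ]))
vandermonde x y l zero = sym (begin
  fromℕ 1 * (1# * 1#) + 0#   ≈⟨ +-identityʳ (fromℕ 1 * (1# * 1#)) ⟩
  fromℕ 1 * (1# * 1#)        ≈⟨ *-cong fromℕ-1 (*-identityˡ 1#) ⟩
  1# * 1#                    ≈⟨ *-identityˡ 1# ⟩
  1#                         ∎)
vandermonde x y l (suc m) = begin
  ⟨ y + x ⟩[ m , l ] * z
    ≈⟨ *-congʳ (vandermonde x y l m) ⟩
  ∑[ r < suc m ] t (toℕ r) * z
    ≈⟨ *-comm (∑[ r < suc m ] t (toℕ r)) z ⟩
  z * ∑[ r < suc m ] t (toℕ r)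
    ≈⟨ *-distribˡ-sum {suc m} z (t ∘ toℕ) ⟩
  ∑[ r < suc m ] (z * t (toℕ r))
    ≈⟨ sum-cong-≋ {suc m} (λ r → term (toℕ r) (s≤s⁻¹ (toℕ<n r))) ⟩
  ∑[ r < suc m ] (fromℕ (m C toℕ r) * (f (toℕ r) + f (suc (toℕ r))))
    ≈⟨ sym (∑-pascal m f) ⟩
  ∑[ r < suc (suc m) ] (fromℕ (suc m C toℕ r) * f (toℕ r)) ∎
  where
  z : ℝ
  z = y + x - fromℕ m * l

  f t : ℕ → ℝ
  f r = ⟨ x ⟩[ r , l ] * ⟨ y ⟩[ suc m ∸ r , l ]
  t r = fromℕ (m C r) * (⟨ x ⟩[ r , l ] * ⟨ y ⟩[ m ∸ r , l ])

  term : ∀ r → r ℕ.≤ m → z * t r ≃ fromℕ (m C r) * (f r + f (suc r))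
  term r r≤m = begin
    z * t r
      ≈⟨ *-congʳ (trans
           (reflexive (≡.cong (λ i → y + x - fromℕ i * l) (≡.sym (ℕₚ.m+[n∸m]≡n r≤m))))
           (factor-split x y l r (m ∸ r))) ⟩
    (a + b) * t r
      ≈⟨ solve 5 (λ a b c p q →
           (a :+ b) :* (c :* (p :* q)) := c :* (p :* (q :* b) :+ p :* a :* q)) refl
           a b (fromℕ (m C r)) ⟨ x ⟩[ r , l ] ⟨ y ⟩[ m ∸ r , l ] ⟩
    fromℕ (m C r) * (⟨ x ⟩[ r , l ] * ⟨ y ⟩[ suc (m ∸ r) , l ] + f (suc r))
      -- Only `f r` needs `r≤m` here; in `f (suc r)` the index `suc m ∸ suc r` computes to `m ∸ r`.
      ≈⟨ *-congˡ {fromℕ (m C r)} (+-congʳ {f (suc r)} (reflexive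
           (≡.cong (λ i → ⟨ x ⟩[ r , l ] * ⟨ y ⟩[ i , l ]) (≡.sym (ℕₚ.+-∸-assoc 1 r≤m))))) ⟩
    fromℕ (m C r) * (f r + f (suc r)) ∎
    where
    a b : ℝ
    a = x - fromℕ r * l
    b = y - fromℕ (m ∸ r) * l

-- The coefficient of `⟨ x ⟩[ r , l ]` in the expansion of `⟨ 1# + x ⟩[ suc k , l ]`.
coeff : ℝ → ℕ → ℕ → ℝ
coeff l k r = fromℕ (suc k C r) * ⟨ 1# ⟩[ suc k ∸ r , l ]

[1+k]Ck≡1+k : ∀ k → suc k C k ≡ suc k
[1+k]Ck≡1+k k = ≡.trans (nCk≡nC[n∸k] (ℕₚ.n≤1+n k))
  (≡.trans (≡.cong (suc k C_) (ℕₚ.m+n∸n≡m 1 k)) (nC1≡n (suc k)))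

coeff-last : ∀ l k → coeff l k k ≃ fromℕ (suc k)
coeff-last l k = begin
  fromℕ (suc k C k) * ⟨ 1# ⟩[ suc k ∸ k , l ]
    ≈⟨ *-cong (reflexive (≡.cong fromℕ ([1+k]Ck≡1+k k)))
         (reflexive (≡.cong (λ i → ⟨ 1# ⟩[ i , l ]) (ℕₚ.m+n∸n≡m 1 k))) ⟩
  fromℕ (suc k) * ⟨ 1# ⟩[ 1 , l ]
    ≈⟨ *-congˡ (⟨⟩-1 1# l) ⟩
  fromℕ (suc k) * 1#
    ≈⟨ *-identityʳ (fromℕ (suc k)) ⟩
  fromℕ (suc k) ∎

-- The term `r = suc k` of Vandermonde's identity has coefficient 1; splitting it off gives the
-- recurrence that `∑-telescope` expects.
⟨1+x⟩-step : ∀ x l k → ⟨ 1# + x ⟩[ suc k , l ] ≃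
  ∑[ r < suc k ] (coeff l k (toℕ r) * ⟨ x ⟩[ toℕ r , l ]) + ⟨ x ⟩[ suc k , l ]
⟨1+x⟩-step x l k = begin
  ⟨ 1# + x ⟩[ suc k , l ]
    ≈⟨ vandermonde x 1# l (suc k) ⟩
  ∑[ r < suc (suc k) ] h (toℕ r)
    ≈⟨ ∑-last (suc k) h ⟩
  ∑[ r < suc k ] h (toℕ r) + h (suc k)
    ≈⟨ +-cong (sum-cong-≋ {suc k} λ r → solve 3 (λ a b c → a :* (b :* c) := a :* c :* b) refl
                (fromℕ (suc k C toℕ r)) ⟨ x ⟩[ toℕ r , l ] ⟨ 1# ⟩[ suc k ∸ toℕ r , l ])
              top ⟩
  ∑[ r < suc k ] (coeff l k (toℕ r) * ⟨ x ⟩[ toℕ r , l ]) + ⟨ x ⟩[ suc k , l ] ∎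
  where
  h : ℕ → ℝ
  h r = fromℕ (suc k C r) * (⟨ x ⟩[ r , l ] * ⟨ 1# ⟩[ suc k ∸ r , l ])

  top : h (suc k) ≃ ⟨ x ⟩[ suc k , l ]
  top = begin
    h (suc k)
      ≈⟨ *-cong (trans (reflexive (≡.cong fromℕ (nCn≡1 (suc k)))) fromℕ-1)
           (*-congˡ (reflexive (≡.cong (λ i → ⟨ 1# ⟩[ i , l ]) (ℕₚ.n∸n≡0 k)))) ⟩
    1# * (⟨ x ⟩[ suc k , l ] * 1#)
      ≈⟨ *-identityˡ (⟨ x ⟩[ suc k , l ] * 1#) ⟩
    ⟨ x ⟩[ suc k , l ] * 1#
      ≈⟨ *-identityʳ ⟨ x ⟩[ suc k , l ] ⟩
    ⟨ x ⟩[ suc k , l ] ∎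

∑-coeff*S : ∀ l n k → ⟨ fromℕ (suc n) ⟩[ suc k , l ] ≃
  ∑[ r < suc k ] (coeff l k (toℕ r) * S (toℕ r) l n) + ⟨ 1# ⟩[ suc k , l ]
∑-coeff*S l n k = begin
  ⟨ fromℕ (suc n) ⟩[ suc k , l ]
    -- The shift to `suc j` matches the indexing of `S` and starts the telescope at 1. The step fits
    -- because `fromℕ (suc (suc j))` unfolds to `1# + fromℕ (suc j)`.
    ≈⟨ ∑-telescope (λ j → ⟨ fromℕ (suc j) ⟩[ suc k , l ]) (λ j → ∑[ r < suc k ] d j (toℕ r))
         (λ j → ⟨1+x⟩-step (fromℕ (suc j)) l k) n ⟩
  ∑[ j < n ] ∑[ r < suc k ] d (toℕ j) (toℕ r) + ⟨ fromℕ 1 ⟩[ suc k , l ]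
    ≈⟨ +-cong (∑-comm {n} {suc k} (λ j r → d (toℕ j) (toℕ r))) (⟨⟩-cong (suc k) l fromℕ-1) ⟩
  ∑[ r < suc k ] ∑[ j < n ] d (toℕ j) (toℕ r) + ⟨ 1# ⟩[ suc k , l ]
    ≈⟨ +-congʳ (sum-cong-≋ {suc k} λ r → sym (*-distribˡ-sum {n} (coeff l k (toℕ r))
         (λ j → ⟨ fromℕ (suc (toℕ j)) ⟩[ toℕ r , l ]))) ⟩
  ∑[ r < suc k ] (coeff l k (toℕ r) * S (toℕ r) l n) + ⟨ 1# ⟩[ suc k , l ] ∎
  where
  d : ℕ → ℕ → ℝ
  d j r = coeff l k r * ⟨ fromℕ (suc j) ⟩[ r , l ]

/-solve : ∀ {a b t} s d .{{_ : NonZero d}} → a ≃ t + fromℕ d * s + b →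
  s ≃ (a - b) / d - (1# / d) * t
/-solve {a} {b} {t} s d a≃ = sym (begin
  (a - b) / d - (1# / d) * t
    ≈⟨ +-congʳ (*-congʳ (trans (+-congʳ a≃) (//-rightDividesʳ b (t + fromℕ d * s)))) ⟩
  (t + fromℕ d * s) / d - (1# / d) * t
    ≈⟨ +-congʳ (trans
         (solve 4 (λ t c s u → (t :+ c :* s) :* u := c :* (s :* u) :+ u :* t) refl t (fromℕ d) s _)
         -- `1# / d` is `1#` times the constant 1/d, hence the inserted unit.
         (+-cong (/-cancel s d) (*-congʳ (sym (*-identityˡ _))))) ⟩
  s + (1# / d) * t - (1# / d) * t
    ≈⟨ //-rightDividesʳ ((1# / d) * t) s ⟩
  s ∎)

theorem2p3 : (l : ℝ) (n : ℕ) .{{_ : NonZero n}} (k : ℕ) .{{_ : NonZero k}} →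
    S k l n ≃ (⟨ fromℕ (suc n) ⟩[ suc k , l ] - ⟨ 1# ⟩[ suc k , l ]) / suc k
              - (1# / suc k) * (∑[ r < k ] (fromℕ (suc k C toℕ r) * ⟨ 1# ⟩[ suc k ∸ toℕ r , l ] * S (toℕ r) l n))
-- Here `t` is the sum over `r < k`, and the split-off term `r = k` supplies
-- `fromℕ (suc k) * S k l n`.
theorem2p3 l n k = /-solve (S k l n) (suc k) (trans (∑-coeff*S l n k) (+-congʳ (trans
  (∑-last k (λ r → coeff l k r * S r l n))
  (+-congˡ (*-congʳ (coeff-last l k))))))
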